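{- Let $(S,\mathcal C)$ be a connectoid. For every end $\omega$ of $(S,\mathcal C)$ there is a unique direction $d_\omega$ of $(S,\mathcal C)$ such that $d_\omega(A)=K(A,\omega)$ for every finite set $A\subseteq S$. The map $\omega\mapsto d_\omega$ is a bijection between $\Omega(S,\mathcal C)$ and the set of directions of $(S,\mathcal C)$.
   Context: A connectoid is given by a set $S$ and a set $\mathcal F$ of finite subsets of $S$ such that (i) $F\cup F'\in\mathcal F$ whenever $F,F'\in\mathcal F$ and $F\cap F'\neq\emptyset$, and (ii) $\emptyset\in\mathcal F$ and $\{s\}\in\mathcal F$ for every $s\in S$. A set $C\subseteq S$ is connected if for all $x,y\in C$ there is $F\in\mathcal F$ with $F\subseteq C$ and $x,y\in F$; $\mathcal C$ is the set of connected sets and $(S,\mathcal C)$ is the connectoid (the finite connected sets are exactly the elements of $\mathcal F$). For $S'\subseteq S$, a component of $S'$ is a maximal connected subset of $S'$, and $\mathcal K(S')$ is the set of components of $S'$ (it partitions $S'$). "Almost all" means all but finitely many. A necklace is a connected set $N$ for which there is a family $(H_n)_{n\in\mathbb N}$ of finite connected sets with $N=\bigcup_n H_n$ and $H_i\cap H_j\neq\emptyset$ iff $|i-j|\le 1$. For a necklace $N$ and finite $X\subseteq S$, exactly one element of $\mathcal K(N\setminus X)$ contains almost all elements of $N$; it is called the $X$-tail of $N$. Two necklaces are equivalent if for every finite $X\subseteq S$ their $X$-tails are contained in the same element of $\mathcal K(S\setminus X)$. An end is an equivalence class of necklaces; $\Omega(S,\mathcal C)$ is the set of ends. For an end $\omega$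 and finite $X\subseteq S$, $K(X,\omega)$ denotes the element of $\mathcal K(S\setminus X)$ containing the $X$-tails of all necklaces in $\omega$. A direction of $(S,\mathcal C)$ is a map $d$ assigning to every finite $A\subseteq S$ an element $d(A)\in\mathcal K(S\setminus A)$ such that $d(B)\subseteq d(A)$ whenever $A\subseteq B$ are finite subsets of $S$. -}

module Defs where

open import Data.List.Base using (List; []; [_]; _++_)
import Data.List.Membership.Propositional as List
import Data.List.Relation.Binary.Subset.Propositional as List
open import Data.Nat.Base using (ℕ; _≤_; ∣_-_∣)
open import Data.Product.Base using (Σ-syntax; ∃-syntax; _×_)
open import Function.Bundles using (_⇔_)
open import Level using (Level; suc)
open import Relation.Binary.Bundles using (Setoid)
import Relation.Binary.Construct.On as On
open import Relation.Unary using (Pred; _∈_; _⊆_; _≐_; _≬_; _∖_; ∁; ⋃; Satisfiable)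
open import Relation.Unary.Properties using (≐-refl; ≐-sym; ≐-trans)
open import Relation.Unary.Relation.Binary.Equality using (≐-setoid)

-- A finite subset is presented by a list of its elements, in any order and
-- possibly with repetitions; ⟦ F ⟧ is the subset presented by F.
⟦_⟧ : ∀ {ℓ} {S : Set ℓ} → List S → Pred S ℓ
⟦ F ⟧ = λ s → s List.∈ F

record Connectoid (ℓ : Level) : Set (suc ℓ) where
  field
    S : Set ℓ
    𝓕 : Pred (List S) ℓ
    -- 𝓕 is a set of finite subsets: membership does not depend on the list
    -- presenting a subset.
    𝓕-resp : ∀ {F F′} → ⟦ F ⟧ ≐ ⟦ F′ ⟧ → F ∈ 𝓕 → F′ ∈ 𝓕
    𝓕-∪ : ∀ {F F′} → F ∈ 𝓕 → F′ ∈ 𝓕 → ⟦ F ⟧ ≬ ⟦ F′ ⟧ → (F ++ F′) ∈ 𝓕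
    𝓕-∅ : [] ∈ 𝓕
    𝓕-singleton : ∀ s → [ s ] ∈ 𝓕

module Ends {ℓ : Level} (𝒮 : Connectoid ℓ) where
  open Connectoid 𝒮

  Subset : Set (suc ℓ)
  Subset = Pred S ℓ

  Connected : Subset → Set ℓ
  Connected C = ∀ {x y} → x ∈ C → y ∈ C →
    ∃[ F ] F ∈ 𝓕 × ⟦ F ⟧ ⊆ C × x ∈ ⟦ F ⟧ × y ∈ ⟦ F ⟧

  -- IsComponent S′ K says K ∈ 𝒦(S′).  Since 𝒦(S′) is a partition of S′, its
  -- elements are nonempty; in particular 𝒦(∅) is empty.
  record IsComponent (S′ K : Subset) : Set (suc ℓ) where
    field
      subset    : K ⊆ S′
      nonempty  : Satisfiable K
      connected : Connected K
      maximal   : ∀ {C : Subset} → Connected C → C ⊆ S′ → K ⊆ C → C ⊆ K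

  record IsNecklace (N : Subset) : Set ℓ where
    field
      connected        : Connected N
      H                : ℕ → List S
      H-connected      : ∀ n → Connected ⟦ H n ⟧
      union            : N ≐ ⋃ ℕ (λ n → ⟦ H n ⟧)
      meets-iff-nearby : ∀ i j → (⟦ H i ⟧ ≬ ⟦ H j ⟧) ⇔ (∣ i - j ∣ ≤ 1)

  record Necklace : Set (suc ℓ) where
    field
      carrier    : Subset
      isNecklace : IsNecklace carrier

  open Necklace public

  ContainsAlmostAll : Subset → Subset → Set ℓ
  ContainsAlmostAll T N = Σ[ E ∈ List S ] (N ∖ T) ⊆ ⟦ E ⟧

  -- T is the X-tail of N.
  record IsTail (X : List S) (N : Necklace) (T : Subset) : Set (suc ℓ) where
    field
      component : IsComponent (carrier N ∖ ⟦ X ⟧) T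
      almostAll : ContainsAlmostAll T (carrier N)

  TailContainedIn : List S → Necklace → Subset → Set (suc ℓ)
  TailContainedIn X N K = ∃[ T ] IsTail X N T × T ⊆ K

  Equivalent : Necklace → Necklace → Set (suc ℓ)
  Equivalent N N′ = ∀ (X : List S) →
    ∃[ K ] IsComponent (∁ ⟦ X ⟧) K × TailContainedIn X N K × TailContainedIn X N′ K

  record End : Set (suc (suc ℓ)) where
    field
      necklaces          : Pred Necklace (suc ℓ)
      isEquivalenceClass : ∃[ N ] necklaces ≐ Equivalent N

  open End public

  -- K is the set K(X,ω).
  IsK : List S → End → Subset → Set (suc ℓ)
  IsK X ω K = IsComponent (∁ ⟦ X ⟧) K ×
    (∀ {N} → N ∈ necklaces ω → TailContainedIn X N K)

  -- By monotonicity, lists presenting the same finite set have the same image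
  -- (up to ≐), so dir is a map on finite subsets.
  record Direction : Set (suc ℓ) where
    field
      dir       : List S → Subset
      component : ∀ A → IsComponent (∁ ⟦ A ⟧) (dir A)
      monotone  : ∀ {A B} → A List.⊆ B → dir B ⊆ dir A

  open Direction public using (dir)

  Ω : Setoid (suc (suc ℓ)) (suc ℓ)
  Ω = On.setoid (≐-setoid Necklace (suc ℓ)) necklaces

  Directions : Setoid (suc ℓ) ℓ
  Directions = record
    { Carrier       = Direction
    ; _≈_           = λ d d′ → ∀ A → dir d A ≐ dir d′ A
    ; isEquivalence = record
      { refl  = λ _ → ≐-refl
      ; sym   = λ p A → ≐-sym (p A)
      ; trans = λ p q A → ≐-trans (p A) (q A)
      }
    }

-- A direction d determines a necklace as follows.  Keep a finite set P of elements
-- used so far and pick knots a₀, a₁, … with aₙ ∈ d(Pₙ); both aₙ and aₙ₊₁ lie in the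
-- connected set d(Pₙ), so a finite connected Hₙ₊₁ ⊆ d(Pₙ) joins them, and Hₙ₊₁ misses
-- H₀, …, Hₙ₋₁ ⊆ Pₙ.  Its end induces d as soon as, for each finite X, almost all aₙ lie
-- in d(X).  Call t ∈ T inseparable if t ∈ d(Z) for every finite Z disjoint from T.
--   * If every finite set is disjoint from a finite T with an inseparable t ∈ T, choose
--     aₙ = tₙ with pairwise disjoint Tₙ: then aₙ ∈ d(X) once Tₙ misses X.
--   * Otherwise there is a finite Y such that every finite T disjoint from Y has a finite
--     Z disjoint from T with d(Z) ∩ T = ∅.  Choosing disjoint Zₙ ∖ Y successively yields
--     decreasing sets Dₙ = d(Zₙ ∪ Y) ∋ aₙ with empty intersection, so Dₙ misses X for
--     large n, whence aₙ ∈ Dₙ ⊆ d(X).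
module Submission where

open import Defs
open import Axiom.ExcludedMiddle using (ExcludedMiddle)
open import Data.Empty using (⊥-elim)
open import Data.List.Base using (List; []; _∷_; [_]; _++_; map; concat; upTo; filter)
open import Data.List.Membership.Propositional.Properties
  using (∈-++⁺ˡ; ∈-++⁺ʳ; ∈-++⁻; ∈-map⁺; ∈-concat⁺′; ∈-upTo⁺; ∈-filter⁺; ∈-filter⁻)
import Data.List.Relation.Binary.Subset.Propositional as List
open import Data.List.Relation.Unary.Any using (here; there)
open import Data.Nat.Base using (ℕ; zero; suc; _+_; _≤_; _<_; _⊔_; ∣_-_∣; z≤n; s≤s; s≤s⁻¹)
open import Data.Nat.Properties
  using ( ≤-refl; ≤-reflexive; ≤-trans; <⇒≱; ≮⇒≥; _<?_; m≤n⇒m≤1+n; m≤m+n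
        ; m≤m⊔n; m≤n⊔m; m≤n+∣n-m∣; m≤n⇒m<n∨m≡n; +-comm; +-monoʳ-≤; ∣m-m+n∣≡n
        ; m≤n⇒∃[o]m+o≡n)
open import Data.Product using (Σ-syntax; ∃-syntax; ∃!; _×_; _,_; proj₁; proj₂)
open import Data.Sum.Base using (_⊎_; inj₁; inj₂; [_,_]′)
open import Function.Base using (_∘_; id)
open import Function.Bundles using (mk⇔; Equivalence)
open import Function.Structures using (IsBijection)
import Level
open import Relation.Binary.Bundles using (Setoid)
open import Relation.Binary.PropositionalEquality using (_≡_; refl; sym; trans; cong; subst)
open import Relation.Nullary using (¬_; yes; no; contradiction)
open import Relation.Nullary.Decidable using (decidable-stable)
open import Relation.Unary
  using (Pred; _∈_; _∉_; _⊆_; _≐_; _≬_; _∖_; _∪_; ∁; ⋃; Satisfiable)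
open import Relation.Unary.Properties using (≐-refl; ≐-sym)

-- Eventual avoidance of finite sets and distances between indices.

Eventually : ∀ {ℓ} → (ℕ → Set ℓ) → Set ℓ
Eventually P = ∃[ m ] (∀ n → m ≤ n → P n)

eventually-avoids-list : ∀ {ℓ} {S : Set ℓ} (A : ℕ → Pred S ℓ) (X : List S) →
  (∀ x → x ∈ ⟦ X ⟧ → Eventually (λ n → x ∉ A n)) → Eventually (λ n → A n ⊆ ∁ ⟦ X ⟧)
eventually-avoids-list A [] _ = 0 , λ _ _ _ ()
eventually-avoids-list A (x ∷ X) h
  with h x (here refl) | eventually-avoids-list A X (λ y → h y ∘ there)
... | k , x∉ | m , X∉ = k ⊔ m , λ where
  n k⊔m≤n y∈A (here refl) → x∉ n (≤-trans (m≤m⊔n k m) k⊔m≤n) y∈A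
  n k⊔m≤n y∈A (there y∈X) → X∉ n (≤-trans (m≤n⊔m k m) k⊔m≤n) y∈A y∈X

-- The gap of two leaves consecutive sets free to meet, as beads of a necklace must.
Separated : ∀ {ℓ} {S : Set ℓ} → (ℕ → Pred S ℓ) → Set ℓ
Separated A = ∀ {i j x} → 2 + i ≤ j → x ∈ A i → x ∉ A j

∣i-j∣≤1-cases : ∀ i j → ∣ i - j ∣ ≤ 1 → i ≡ j ⊎ j ≡ suc i ⊎ i ≡ suc j
∣i-j∣≤1-cases zero zero _ = inj₁ refl
∣i-j∣≤1-cases zero (suc zero) _ = inj₂ (inj₁ refl)
∣i-j∣≤1-cases zero (suc (suc _)) (s≤s ())
∣i-j∣≤1-cases (suc zero) zero _ = inj₂ (inj₂ refl)
∣i-j∣≤1-cases (suc (suc _)) zero (s≤s ())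
∣i-j∣≤1-cases (suc i) (suc j) p with ∣i-j∣≤1-cases i j p
... | inj₁ i≡j = inj₁ (cong suc i≡j)
... | inj₂ (inj₁ j≡1+i) = inj₂ (inj₁ (cong suc j≡1+i))
... | inj₂ (inj₂ i≡1+j) = inj₂ (inj₂ (cong suc i≡1+j))

∣i-j∣≤1-or-far : ∀ i j → ∣ i - j ∣ ≤ 1 ⊎ 2 + i ≤ j ⊎ 2 + j ≤ i
∣i-j∣≤1-or-far zero zero = inj₁ z≤n
∣i-j∣≤1-or-far zero (suc zero) = inj₁ ≤-refl
∣i-j∣≤1-or-far zero (suc (suc j)) = inj₂ (inj₁ (s≤s (s≤s z≤n)))
∣i-j∣≤1-or-far (suc zero) zero = inj₁ ≤-refl
∣i-j∣≤1-or-far (suc (suc i)) zero = inj₂ (inj₂ (s≤s (s≤s z≤n)))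
∣i-j∣≤1-or-far (suc i) (suc j) with ∣i-j∣≤1-or-far i j
... | inj₁ p = inj₁ p
... | inj₂ (inj₁ p) = inj₂ (inj₁ (s≤s p))
... | inj₂ (inj₂ p) = inj₂ (inj₂ (s≤s p))

-- Linked points, components, and chains of finite connected sets.

module Linking {ℓ} (𝒮 : Connectoid ℓ) where
  open Connectoid 𝒮
  open Ends 𝒮

  -- For `x ∈ C`, the subset `Linked C x` is the component of `x` in `C`.
  Linked : Subset → S → S → Set ℓ
  Linked C x y = ∃[ F ] F ∈ 𝓕 × ⟦ F ⟧ ⊆ C × x ∈ ⟦ F ⟧ × y ∈ ⟦ F ⟧

  linked-refl : ∀ {C x} → x ∈ C → Linked C x x
  linked-refl {x = x} x∈C =
    [ x ] , 𝓕-singleton x , (λ where (here refl) → x∈C) , here refl , here refl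

  linked-sym : ∀ {C x y} → Linked C x y → Linked C y x
  linked-sym (F , F∈𝓕 , F⊆C , x∈F , y∈F) = F , F∈𝓕 , F⊆C , y∈F , x∈F

  linked-trans : ∀ {C x y z} → Linked C x y → Linked C y z → Linked C x z
  linked-trans {y = y} (F , F∈𝓕 , F⊆C , x∈F , y∈F) (G , G∈𝓕 , G⊆C , y∈G , z∈G) =
    F ++ G , 𝓕-∪ F∈𝓕 G∈𝓕 (y , y∈F , y∈G)
    , [ F⊆C , G⊆C ]′ ∘ ∈-++⁻ F , ∈-++⁺ˡ x∈F , ∈-++⁺ʳ F z∈G

  linked-mono : ∀ {C D x y} → C ⊆ D → Linked C x y → Linked D x y
  linked-mono C⊆D (F , F∈𝓕 , F⊆C , ends) = F , F∈𝓕 , C⊆D ∘ F⊆C , ends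

  linked⇒∈ : ∀ {C x y} → Linked C x y → y ∈ C
  linked⇒∈ (_ , _ , F⊆C , _ , y∈F) = F⊆C y∈F

  star⇒connected : ∀ {C x} → (∀ {y} → y ∈ C → Linked C x y) → Connected C
  star⇒connected star y∈C z∈C = linked-trans (linked-sym (star y∈C)) (star z∈C)

  𝓕⇒connected : ∀ {F} → F ∈ 𝓕 → Connected ⟦ F ⟧
  𝓕⇒connected {F} F∈𝓕 x∈F y∈F = F , F∈𝓕 , id , x∈F , y∈F

  linked-connected : ∀ C x → Connected (Linked C x)
  -- The same `F` serves again: `F` itself links `x` to each point of `F`.
  linked-connected C x = star⇒connected λ (F , F∈𝓕 , F⊆C , x∈F , y∈F) →
    F , F∈𝓕 , (λ z∈F → F , F∈𝓕 , F⊆C , x∈F , z∈F) , x∈F , y∈F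

  linked-component : ∀ {C x} → x ∈ C → IsComponent C (Linked C x)
  linked-component {C} {x} x∈C = record
    { subset    = linked⇒∈
    ; nonempty  = x , linked-refl x∈C
    ; connected = linked-connected C x
    ; maximal   = λ D-conn D⊆C x⊆D y∈D → linked-mono D⊆C (D-conn (x⊆D (linked-refl x∈C)) y∈D)
    }

  ∪-connected : ∀ {C D} → Connected C → Connected D → C ≬ D → Connected (C ∪ D)
  ∪-connected C-conn D-conn (_ , z∈C , z∈D) = star⇒connected λ where
    (inj₁ y∈C) → linked-mono inj₁ (C-conn z∈C y∈C)
    (inj₂ y∈D) → linked-mono inj₂ (D-conn z∈D y∈D)

  -- The union with `K` is connected because the two sets meet, so maximality of `K` applies to it.
  component-absorbs : ∀ {S′ K C} → IsComponent S′ K → Connected C → C ⊆ S′ → C ≬ K → C ⊆ K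
  component-absorbs K-comp C-conn C⊆S′ C≬K =
    maximal (∪-connected C-conn connected C≬K) [ C⊆S′ , subset ]′ inj₂ ∘ inj₁
    where open IsComponent K-comp

  component-unique : ∀ {S′ K K′} → IsComponent S′ K → IsComponent S′ K′ → K ≬ K′ → K ≐ K′
  component-unique K-comp K′-comp K≬K′@(x , x∈K , x∈K′) =
    component-absorbs K′-comp (connected K-comp) (subset K-comp) K≬K′ ,
    component-absorbs K-comp (connected K′-comp) (subset K′-comp) (x , x∈K′ , x∈K)
    where open IsComponent

  Chain : (ℕ → List S) → Set ℓ
  Chain H = ∀ n → ⟦ H n ⟧ ≬ ⟦ H (suc n) ⟧

  From : (ℕ → List S) → ℕ → Subset
  From H m x = ∃[ n ] m ≤ n × x ∈ ⟦ H n ⟧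

  chain-connected : ∀ {H} → (∀ n → Connected ⟦ H n ⟧) → Chain H → ∀ m → Connected (From H m)
  chain-connected {H} H-conn chain m = star⇒connected λ (n , m≤n , y∈Hn) →
    let k , m+k≡n = m≤n⇒∃[o]m+o≡n m≤n in
    -- The hub is a common point of `H m` and `H (suc m)`. The index is written `k + m` because
    -- `suc k + m` then reduces to `suc (k + m)`, matching `chain (k + m)`.
    linked-base k (subst (λ i → _ ∈ ⟦ H i ⟧) (trans (sym m+k≡n) (+-comm m k)) y∈Hn)
    where
    within : ∀ k {x y} → x ∈ ⟦ H (k + m) ⟧ → y ∈ ⟦ H (k + m) ⟧ → Linked (From H m) x y
    within k x∈ y∈ = linked-mono
      (λ z∈ → k + m , subst (m ≤_) (+-comm m k) (m≤m+n m k) , z∈) (H-conn (k + m) x∈ y∈)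

    linked-base : ∀ k {y} → y ∈ ⟦ H (k + m) ⟧ → Linked (From H m) (proj₁ (chain m)) y
    linked-base zero y∈ = within zero (proj₁ (proj₂ (chain m))) y∈
    linked-base (suc k) y∈ =
      let z , z∈ , z∈′ = chain (k + m) in linked-trans (linked-base k z∈) (within (suc k) z∈′ y∈)

  chain⇒necklace : (H : ℕ → List S) → (∀ n → H n ∈ 𝓕) → Chain H → Separated (⟦_⟧ ∘ H) → Necklace
  chain⇒necklace H H∈𝓕 chain separated = record
    { carrier    = ⋃ ℕ (λ n → ⟦ H n ⟧)
    ; isNecklace = record
      { connected        = λ (i , x∈) (j , y∈) →
          linked-mono (λ (n , _ , z∈) → n , z∈)
            (chain-connected H-conn chain 0 (i , z≤n , x∈) (j , z≤n , y∈))
      ; H                = H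
      ; H-connected      = H-conn
      ; union            = ≐-refl
      ; meets-iff-nearby = λ i j → mk⇔ (meets⇒nearby i j) (nearby⇒meets i j ∘ ∣i-j∣≤1-cases i j)
      }
    }
    where
    H-conn : ∀ n → Connected ⟦ H n ⟧
    H-conn n = 𝓕⇒connected (H∈𝓕 n)

    meets⇒nearby : ∀ i j → ⟦ H i ⟧ ≬ ⟦ H j ⟧ → ∣ i - j ∣ ≤ 1
    meets⇒nearby i j (x , x∈Hi , x∈Hj) with ∣i-j∣≤1-or-far i j
    ... | inj₁ nearby = nearby
    ... | inj₂ (inj₁ far) = contradiction x∈Hj (separated far x∈Hi)
    ... | inj₂ (inj₂ far) = contradiction x∈Hi (separated far x∈Hj)

    nearby⇒meets : ∀ i j → i ≡ j ⊎ j ≡ suc i ⊎ i ≡ suc j → ⟦ H i ⟧ ≬ ⟦ H j ⟧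
    nearby⇒meets i _ (inj₁ refl) = let x , x∈ , _ = chain i in x , x∈ , x∈
    nearby⇒meets i _ (inj₂ (inj₁ refl)) = chain i
    nearby⇒meets _ j (inj₂ (inj₂ refl)) = let x , x∈ , x∈′ = chain j in x , x∈′ , x∈

-- Tails of a necklace.

module Classical {ℓ} (em : ExcludedMiddle ℓ) (𝒮 : Connectoid ℓ) where
  open Connectoid 𝒮
  open Ends 𝒮
  open Linking 𝒮

  by-contradiction : {P : Set ℓ} → ¬ ¬ P → P
  by-contradiction = decidable-stable em

  -- A point of `A i` is gone from index `2 + i` on, and a point in no `A i` never occurs;
  -- finiteness of `X` makes the bound uniform.
  separated-avoids : {A : ℕ → Subset} → Separated A → ∀ X → Eventually (λ n → A n ⊆ ∁ ⟦ X ⟧)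
  separated-avoids {A} separated X = eventually-avoids-list A X λ x _ → avoids x
    where
    avoids : ∀ x → Eventually (λ n → x ∉ A n)
    avoids x with em {P = ∃[ i ] x ∈ A i}
    ... | yes (i , x∈Ai) = 2 + i , λ n i+2≤n → separated i+2≤n x∈Ai
    ... | no ∄i = 0 , λ n _ x∈An → ∄i (n , x∈An)

  module _ (N : Necklace) where
    open IsNecklace (isNecklace N)
    open Equivalence

    necklace-chain : Chain H
    necklace-chain n = from (meets-iff-nearby n (suc n))
      (≤-reflexive (trans (cong (∣ n -_∣) (+-comm 1 n)) (∣m-m+n∣≡n n 1)))

    necklace-separated : Separated (⟦_⟧ ∘ H)
    necklace-separated {i} {j} {x} 2+i≤j x∈Hi x∈Hj =
      <⇒≱ 2+i≤j (≤-trans (m≤n+∣n-m∣ j i)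
        (≤-trans (+-monoʳ-≤ i (to (meets-iff-nearby i j) (x , x∈Hi , x∈Hj)))
          (≤-reflexive (+-comm i 1))))

    bead⊆carrier : ∀ n → ⟦ H n ⟧ ⊆ carrier N
    bead⊆carrier n x∈ = proj₂ union (n , x∈)

    -- Once all beads from `m` on miss `X`, their union is connected in `N ∖ X`. The component of
    -- any point in it therefore misses at most elements of the first `m` beads.
    eventually-tail : ∀ X → Eventually (λ n → ∀ {p} → p ∈ ⟦ H n ⟧ →
      IsTail X N (Linked (carrier N ∖ ⟦ X ⟧) p))
    eventually-tail X with separated-avoids necklace-separated X
    ... | m , avoid = m , λ n m≤n {p} p∈Hn → record
      { component = linked-component (From⊆N∖X (n , m≤n , p∈Hn))
      ; almostAll = initial , λ (x∈N , x∉T) → rest n m≤n p∈Hn x∉T (proj₁ union x∈N)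
      }
      where
      initial : List S
      initial = concat (map H (upTo m))

      From⊆N∖X : From H m ⊆ carrier N ∖ ⟦ X ⟧
      From⊆N∖X (n , m≤n , x∈) = bead⊆carrier n x∈ , avoid n m≤n x∈

      rest : ∀ n → m ≤ n → ∀ {p} → p ∈ ⟦ H n ⟧ → ∀ {x} → ¬ Linked (carrier N ∖ ⟦ X ⟧) p x →
        ∃[ i ] x ∈ ⟦ H i ⟧ → x ∈ ⟦ initial ⟧
      rest n m≤n p∈Hn x∉T (i , x∈Hi) with i <? m
      ... | yes i<m = ∈-concat⁺′ x∈Hi (∈-map⁺ H (∈-upTo⁺ i<m))
      ... | no i≮m = contradiction
        (linked-mono From⊆N∖X
          (chain-connected H-connected necklace-chain m (n , m≤n , p∈Hn) (i , ≮⇒≥ i≮m , x∈Hi)))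
        x∉T

    tail-exists : ∀ X → ∃[ T ] IsTail X N T
    tail-exists X =
      let m , tail = eventually-tail X
          _ , p∈Hm , _ = necklace-chain m
      in _ , tail m ≤-refl p∈Hm

    -- A late bead avoids both finite exceptional sets, and beads are nonempty.
    almostAll-meet : ∀ {T T′} → ContainsAlmostAll T (carrier N) →
      ContainsAlmostAll T′ (carrier N) → T ≬ T′
    almostAll-meet (E , N∖T⊆E) (E′ , N∖T′⊆E′) =
      let n , avoid = separated-avoids {⟦_⟧ ∘ H} necklace-separated (E ++ E′)
          x , x∈Hn , _ = necklace-chain n
          x∉E++E′ = avoid n ≤-refl x∈Hn
          x∈N = bead⊆carrier n x∈Hn
      in x , by-contradiction (λ x∉T → x∉E++E′ (∈-++⁺ˡ (N∖T⊆E (x∈N , x∉T))))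
           , by-contradiction (λ x∉T′ → x∉E++E′ (∈-++⁺ʳ E (N∖T′⊆E′ (x∈N , x∉T′))))

  tailContainers-meet : ∀ {N X X′ K K′} → TailContainedIn X N K → TailContainedIn X′ N K′ → K ≬ K′
  tailContainers-meet {N} (_ , T-tail , T⊆K) (_ , T′-tail , T′⊆K′) =
    let x , x∈T , x∈T′ = almostAll-meet N (IsTail.almostAll T-tail) (IsTail.almostAll T′-tail)
    in x , T⊆K x∈T , T′⊆K′ x∈T′

  tailContainer-unique : ∀ {N X K K′} → IsComponent (∁ ⟦ X ⟧) K → IsComponent (∁ ⟦ X ⟧) K′ →
    TailContainedIn X N K → TailContainedIn X N K′ → K ≐ K′
  tailContainer-unique K-comp K′-comp N-in-K N-in-K′ =
    component-unique K-comp K′-comp (tailContainers-meet N-in-K N-in-K′)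

  equivalent-refl : ∀ N → Equivalent N N
  equivalent-refl N X =
    let T , T-tail = tail-exists N X
        open IsComponent (IsTail.component T-tail)
        p , p∈T = nonempty
        N-in-K : TailContainedIn X N (Linked (∁ ⟦ X ⟧) p)
        N-in-K = T , T-tail , linked-mono (proj₂ ∘ subset) ∘ connected p∈T
    in Linked (∁ ⟦ X ⟧) p , linked-component (proj₂ (subset p∈T)) , N-in-K , N-in-K

  -- From ends to directions.

  module _ (ω : End) where
    private
      N₀ : Necklace
      N₀ = proj₁ (isEquivalenceClass ω)

    representative∈ : N₀ ∈ necklaces ω
    representative∈ = proj₂ (proj₂ (isEquivalenceClass ω)) (equivalent-refl N₀)

    IsK-unique : ∀ {X K K′} → IsK X ω K → IsK X ω K′ → K ≐ K′
    IsK-unique (K-comp , K-tails) (K′-comp , K′-tails) =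
      tailContainer-unique K-comp K′-comp (K-tails representative∈) (K′-tails representative∈)

    IsK-exists : ∀ X → ∃[ K ] IsK X ω K
    IsK-exists X =
      let K , K-comp , N₀-in-K , _ = equivalent-refl N₀ X
      -- Equivalence puts the tails of `N` and `N₀` in a common component `K′`; it equals `K`, since
      -- both contain the tail of `N₀`.
      in K , K-comp , λ N∈ω →
        let K′ , K′-comp , N₀-in-K′ , T , T-tail , T⊆K′ =
              proj₁ (proj₂ (isEquivalenceClass ω)) N∈ω X
        in T , T-tail , proj₁ (tailContainer-unique K′-comp K-comp N₀-in-K′ N₀-in-K) ∘ T⊆K′

    endDirection : Direction
    endDirection = record
      { dir       = λ A → proj₁ (IsK-exists A)
      ; component = λ A → proj₁ (proj₂ (IsK-exists A))
      -- The `A`-tail and `B`-tail of a representative meet, so the two components meet and the one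
      -- for `A` absorbs the one for `B`.
      ; monotone  = λ {A} {B} A⊆B →
          let _ , KA-comp , KA-tails = IsK-exists A
              _ , KB-comp , KB-tails = IsK-exists B
              open IsComponent
          in component-absorbs KA-comp (connected KB-comp) (λ x∈KB → subset KB-comp x∈KB ∘ A⊆B)
               (tailContainers-meet (KB-tails representative∈) (KA-tails representative∈))
      }

    endDirection-IsK : ∀ A → IsK A ω (dir endDirection A)
    endDirection-IsK A = proj₂ (IsK-exists A)

  -- For each `X`, the tail of `N` lies in the component that holds the tail of the representative
  -- of `ω′`, so the two necklaces are equivalent.
  necklaces-determined : ∀ {ω ω′} → (∀ A → dir (endDirection ω) A ≐ dir (endDirection ω′) A) →
    necklaces ω ⊆ necklaces ω′
  necklaces-determined {ω} {ω′} same N∈ω = proj₂ (proj₂ (isEquivalenceClass ω′)) λ X →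
    let _ , tails = endDirection-IsK ω X
        K′-comp , tails′ = endDirection-IsK ω′ X
        T , T-tail , T⊆K = tails N∈ω
    in _ , K′-comp , tails′ (representative∈ ω′) , T , T-tail , proj₁ (same X) ∘ T⊆K

  necklaceEnd : Necklace → End
  necklaceEnd N = record { necklaces = Equivalent N ; isEquivalenceClass = N , ≐-refl }

  -- From directions to necklaces.

  module _ (d : Direction) where
    open Direction d using (component; monotone)
    open IsComponent

    -- `dir d (A ++ B)` is nonempty and lies in both sets, so they meet and `dir d B` absorbs the
    -- other.
    dir-within : ∀ {A B} → dir d A ⊆ ∁ ⟦ B ⟧ → dir d A ⊆ dir d B
    dir-within {A} {B} avoid =
      let p , p∈ = nonempty (component (A ++ B))
      in component-absorbs (component B) (connected (component A)) avoid
           (p , monotone ∈-++⁺ˡ p∈ , monotone (∈-++⁺ʳ A) p∈)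

    -- Whatever the choice of the anchors, the beads form a necklace; `extra` lets
    -- the choice of an anchor record further elements that later beads must avoid.
    module Beads (anchor : List S → S) (extra : List S → List S)
                 (anchor∈dir : ∀ P → anchor P ∈ dir d P) where

      extend : List S → List S → List S
      extend P H = H ++ extra P ++ P

      extend-⊇ : ∀ P H → P List.⊆ extend P H
      extend-⊇ P H = ∈-++⁺ʳ H ∘ ∈-++⁺ʳ (extra P)

      join : ∀ P H → Linked (dir d P) (anchor P) (anchor (extend P H))
      join P H = connected (component P) (anchor∈dir P)
        (monotone (extend-⊇ P H) (anchor∈dir (extend P H)))

      past bead : ℕ → List S
      past zero = []
      past (suc n) = extend (past n) (bead n)
      bead zero = [ anchor [] ]
      -- This joins `knot n` to `knot (suc n)` inside `dir d (past n)`. As `past n` omits `bead n`,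
      -- only beads before `bead n` are sure to be avoided.
      bead (suc n) = proj₁ (join (past n) (bead n))

      knot : ℕ → S
      knot n = anchor (past n)

      past-mono : ∀ {i j} → i ≤ j → past i List.⊆ past j
      past-mono {j = zero} z≤n = id
      past-mono {j = suc j} i≤1+j with m≤n⇒m<n∨m≡n i≤1+j
      ... | inj₁ i<1+j = extend-⊇ (past j) (bead j) ∘ past-mono (s≤s⁻¹ i<1+j)
      ... | inj₂ refl = id

      bead⊆past : ∀ {i j} → i < j → bead i List.⊆ past j
      bead⊆past i<j = past-mono i<j ∘ ∈-++⁺ˡ

      extra⊆past : ∀ {i j} → i < j → extra (past i) List.⊆ past j
      extra⊆past {i} i<j = past-mono i<j ∘ ∈-++⁺ʳ (bead i) ∘ ∈-++⁺ˡ

      bead∈𝓕 : ∀ n → bead n ∈ 𝓕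
      bead∈𝓕 zero = 𝓕-singleton (anchor [])
      bead∈𝓕 (suc n) = proj₁ (proj₂ (join (past n) (bead n)))

      knot∈bead : ∀ n → knot n ∈ ⟦ bead n ⟧
      knot∈bead zero = here refl
      knot∈bead (suc n) = proj₂ (proj₂ (proj₂ (proj₂ (join (past n) (bead n)))))

      knot∈next : ∀ n → knot n ∈ ⟦ bead (suc n) ⟧
      knot∈next n = proj₁ (proj₂ (proj₂ (proj₂ (join (past n) (bead n)))))

      bead⊆dir : ∀ n → ⟦ bead (suc n) ⟧ ⊆ dir d (past n)
      bead⊆dir n = proj₁ (proj₂ (proj₂ (join (past n) (bead n))))

      bead-separated : Separated (⟦_⟧ ∘ bead)
      bead-separated {i} {suc j} (s≤s i<j) x∈bead-i x∈bead-j =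
        subset (component (past j)) (bead⊆dir j x∈bead-j) (bead⊆past i<j x∈bead-i)

      beadNecklace : Necklace
      beadNecklace = chain⇒necklace bead bead∈𝓕
        (λ n → knot n , knot∈bead n , knot∈next n) bead-separated

      Converges : Set ℓ
      Converges = ∀ X → Eventually (λ n → knot n ∈ dir d X)

      -- A late knot lies both in the tail and in `dir d X`; the tail is connected and misses `X`,
      -- so it is absorbed.
      converges⇒tails : Converges → ∀ X → TailContainedIn X beadNecklace (dir d X)
      converges⇒tails converges X =
        let m , tail = eventually-tail beadNecklace X
            k , knot∈ = converges X
            n = m ⊔ k
            n-tail = tail n (m≤m⊔n m k) (knot∈bead n)
            T-component = IsTail.component n-tail
            knot∈dir = knot∈ n (m≤n⊔m m k)
            knot∈N = bead⊆carrier beadNecklace n (knot∈bead n)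
            knot∈T = linked-refl (knot∈N , subset (component X) knot∈dir)
        in _ , n-tail , component-absorbs (component X) (connected T-component)
                          (proj₂ ∘ subset T-component) (knot n , knot∈T , knot∈dir)

    -- Convergence in the inseparable and separable cases.

    ConvergentNecklace : Set (Level.suc ℓ)
    ConvergentNecklace = ∃[ N ] (∀ X → TailContainedIn X N (dir d X))

    Inseparable : List S → S → Set ℓ
    Inseparable T t = t ∈ ⟦ T ⟧ × (∀ Z → ⟦ Z ⟧ ⊆ ∁ ⟦ T ⟧ → t ∈ dir d Z)

    inseparable⇒convergent :
      (∀ P → ∃[ T ] ∃[ t ] ⟦ T ⟧ ⊆ ∁ ⟦ P ⟧ × Inseparable T t) → ConvergentNecklace
    inseparable⇒convergent choose = beadNecklace , converges⇒tails λ X →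
      let m , avoid = separated-avoids {⟦_⟧ ∘ T ∘ past} T-separated X
      in m , λ n m≤n → T-insep (past n) X λ x∈X x∈T → avoid n m≤n x∈T x∈X
      where
      T : List S → List S
      T P = proj₁ (choose P)

      T-avoids : ∀ P → ⟦ T P ⟧ ⊆ ∁ ⟦ P ⟧
      T-avoids P = proj₁ (proj₂ (proj₂ (choose P)))

      T-insep : ∀ P Z → ⟦ Z ⟧ ⊆ ∁ ⟦ T P ⟧ → proj₁ (proj₂ (choose P)) ∈ dir d Z
      T-insep P = proj₂ (proj₂ (proj₂ (proj₂ (choose P))))

      -- Recording `T P` as extra keeps later choices disjoint from it. The anchor lies in `dir d P`
      -- by inseparability, as `P` misses `T P`.
      open Beads (λ P → proj₁ (proj₂ (choose P))) T
        (λ P → T-insep P P λ x∈P x∈T → T-avoids P x∈T x∈P)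

      T-separated : Separated (⟦_⟧ ∘ T ∘ past)
      T-separated {j = j} 2+i≤j x∈Ti x∈Tj =
        T-avoids (past j) x∈Tj (extra⊆past (≤-trans (m≤n⇒m≤1+n ≤-refl) 2+i≤j) x∈Ti)

    separable⇒convergent : (Y : List S) →
      (∀ P → ∃[ Z ] (∀ {x} → x ∈ ⟦ P ⟧ → x ∉ ⟦ Y ⟧ → x ∉ ⟦ Z ⟧ × x ∉ dir d Z)) →
      ConvergentNecklace
    separable⇒convergent Y separate = beadNecklace , converges⇒tails λ X →
      let m , avoid = eventually-avoids-list D X λ x _ → leaves x
      in m , λ n m≤n → dir-within (λ x∈D → avoid n m≤n x∈D) (knot∈D n)
      where
      Z : List S → List S
      Z P = proj₁ (separate P)

      -- Including `P` puts the anchor in `dir d P`; including `Z P ++ Y` puts the knot in `D n`.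
      choice : ∀ P → Satisfiable (dir d (P ++ Z P ++ Y))
      choice P = nonempty (component (P ++ Z P ++ Y))

      open Beads (λ P → proj₁ (choice P)) (λ P → Z P ++ Y)
        (λ P → monotone ∈-++⁺ˡ (proj₂ (choice P)))

      D : ℕ → Subset
      D n = dir d (Z (past n) ++ Y)

      knot∈D : ∀ n → knot n ∈ D n
      knot∈D n = monotone (∈-++⁺ʳ (past n)) (proj₂ (choice (past n)))

      D-avoids-Y : ∀ n → D n ⊆ ∁ ⟦ Y ⟧
      D-avoids-Y n x∈D = subset (component _) x∈D ∘ ∈-++⁺ʳ (Z (past n))

      D-avoids-past : ∀ n → D n ⊆ ∁ ⟦ past n ⟧
      D-avoids-past n x∈D x∈past =
        proj₂ (proj₂ (separate (past n)) x∈past (D-avoids-Y n x∈D)) (monotone ∈-++⁺ˡ x∈D)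

      -- For `i < j`, `past j` contains `Z (past i) ++ Y`, which `D j` therefore misses.
      D-antitone : ∀ {i j} → i ≤ j → D j ⊆ D i
      D-antitone {j = j} i≤j with m≤n⇒m<n∨m≡n i≤j
      ... | inj₁ i<j = dir-within (λ x∈D → D-avoids-past j x∈D ∘ extra⊆past i<j)
      ... | inj₂ refl = id

      Z-separated : Separated (λ n → ⟦ Z (past n) ⟧ ∖ ⟦ Y ⟧)
      Z-separated {j = j} 2+i≤j (x∈Zi , x∉Y) (x∈Zj , _) = proj₁ (proj₂ (separate (past j))
        (extra⊆past (≤-trans (m≤n⇒m≤1+n ≤-refl) 2+i≤j) (∈-++⁺ˡ x∈Zi)) x∉Y) x∈Zj

      -- If x stayed in every D n, a finite connected F ⊆ D 0 joining x to knot 0 ∉ D n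
      -- would have to meet the disjoint sets Z (past n) ∖ Y for all n ≥ 1.
      not-in-all : ∀ x → ¬ (∀ n → x ∈ D n)
      not-in-all x x∈D =
        let F , F∈𝓕 , F⊆D₀ , x∈F , knot∈F = connected (component _) (x∈D 0) (knot∈D 0)
            m , avoid = separated-avoids Z-separated F
            -- The successor ensures that `past n` contains `bead 0`, even when `m` is zero.
            n = suc m
            F-avoids : ⟦ F ⟧ ⊆ ∁ ⟦ Z (past n) ++ Y ⟧
            F-avoids y∈F =
              let y∉Y = D-avoids-Y 0 (F⊆D₀ y∈F)
              in [ (λ y∈Z → avoid n (m≤n⇒m≤1+n ≤-refl) (y∈Z , y∉Y) y∈F) , y∉Y ]′
                 ∘ ∈-++⁻ (Z (past n))
            F⊆D = component-absorbs (component _) (𝓕⇒connected F∈𝓕) F-avoids (x , x∈F , x∈D n)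
        in D-avoids-past n (F⊆D knot∈F) (bead⊆past {0} {n} (s≤s z≤n) (knot∈bead 0))

      leaves : ∀ x → Eventually (λ n → x ∉ D n)
      leaves x with em {P = ∃[ m ] x ∉ D m}
      ... | yes (m , x∉Dm) = m , λ n m≤n → x∉Dm ∘ D-antitone m≤n
      ... | no ∄m = contradiction (λ n → by-contradiction (λ x∉D → ∄m (n , x∉D))) (not-in-all x)

    -- The union of the separators of the single elements still misses `T`, and enlarging a
    -- separator only shrinks the value of `d`.
    separate-list : ∀ T → (∀ {t} → t ∈ ⟦ T ⟧ → ∃[ Z ] ⟦ Z ⟧ ⊆ ∁ ⟦ T ⟧ × t ∉ dir d Z) →
      ∃[ Z ] (⟦ Z ⟧ ⊆ ∁ ⟦ T ⟧ × ⟦ T ⟧ ⊆ ∁ (dir d Z))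
    separate-list T separate = go T id
      where
      go : ∀ U → U List.⊆ T → ∃[ Z ] (⟦ Z ⟧ ⊆ ∁ ⟦ T ⟧ × ⟦ U ⟧ ⊆ ∁ (dir d Z))
      go [] _ = [] , (λ ()) , λ ()
      go (u ∷ U) U⊆T =
        let Z , Z∩T , u∉Z = separate (U⊆T (here refl))
            Z′ , Z′∩T , U∉Z′ = go U (U⊆T ∘ there)
        in Z ++ Z′ , [ Z∩T , Z′∩T ]′ ∘ ∈-++⁻ Z , λ where
          (here refl) → u∉Z ∘ monotone ∈-++⁺ˡ
          (there x∈U) → U∉Z′ x∈U ∘ monotone (∈-++⁺ʳ Z)

    separable : ∀ {T t} → t ∈ ⟦ T ⟧ → ¬ Inseparable T t →
      ∃[ Z ] ⟦ Z ⟧ ⊆ ∁ ⟦ T ⟧ × t ∉ dir d Z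
    separable {T} {t} t∈T ¬insep with em {P = ∃[ Z ] ⟦ Z ⟧ ⊆ ∁ ⟦ T ⟧ × t ∉ dir d Z}
    ... | yes separator = separator
    ... | no ∄Z = ⊥-elim (¬insep
      (t∈T , λ Z Z∩T → by-contradiction λ t∉Z → ∄Z (Z , Z∩T , t∉Z)))

    convergent-necklace : ConvergentNecklace
    convergent-necklace
      with em {P = ∃[ Y ] ¬ (∃[ T ] ∃[ t ] ⟦ T ⟧ ⊆ ∁ ⟦ Y ⟧ × Inseparable T t)}
    ... | no ∄Y = inseparable⇒convergent λ P → by-contradiction λ ∄T → ∄Y (P , ∄T)
    ... | yes (Y , ∄T) = separable⇒convergent Y λ P →
      let outside? = λ x → em {P = x ∉ ⟦ Y ⟧}
          -- This is `P` minus `Y`; being disjoint from `Y`, it has no inseparable element.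
          T = filter outside? P
          T∩Y : ⟦ T ⟧ ⊆ ∁ ⟦ Y ⟧
          T∩Y x∈T = proj₂ (∈-filter⁻ outside? {xs = P} x∈T)
          Z , Z∩T , T∉Z = separate-list T λ t∈T → separable t∈T λ insep → ∄T (T , _ , T∩Y , insep)
      in Z , λ x∈P x∉Y →
        let x∈T = ∈-filter⁺ outside? x∈P x∉Y in (λ x∈Z → Z∩T x∈Z x∈T) , T∉Z x∈T

-- The correspondence between ends and directions.

theorem1p1 : ∀ {ℓ} → ExcludedMiddle ℓ → (𝒮 : Connectoid ℓ) →
    let open Ends 𝒮
        open Setoid Ω using () renaming (_≈_ to _≈Ω_)
        open Setoid Directions using () renaming (_≈_ to _≈D_)
    in Σ[ d ∈ (∀ (ω : End) → ∃! _≈D_ (λ dω → ∀ A → IsK A ω (dir dω A))) ]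
         IsBijection _≈Ω_ _≈D_ (λ ω → proj₁ (d ω))
theorem1p1 em 𝒮 =
  (λ ω → endDirection ω , endDirection-IsK ω ,
    λ d-IsK A → IsK-unique ω (endDirection-IsK ω A) (d-IsK A)) ,
  record
    { isInjection = record
      { isCongruent = record
        { cong           = λ {ω} {ω′} → agree ω ω′
        ; isEquivalence₁ = Setoid.isEquivalence Ω
        ; isEquivalence₂ = Setoid.isEquivalence Directions
        }
      ; injective   = λ {ω} {ω′} same →
          necklaces-determined {ω} {ω′} same , necklaces-determined {ω′} {ω} (≐-sym ∘ same)
      }
    ; surjective  = λ d →
        let N , N-tails = convergent-necklace d
        -- Setoid surjectivity quantifies over every `ω` equal to `necklaceEnd N`. Each contains
        -- `N`, whose tail determines the component.
        in necklaceEnd N , λ {ω} (_ , N⊆ω) A →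
          let K-comp , K-tails = endDirection-IsK ω A
          in tailContainer-unique K-comp (Direction.component d A)
               (K-tails (N⊆ω (equivalent-refl N))) (N-tails A)
    }
  where
  open Ends 𝒮
  open Classical em 𝒮

  agree : ∀ ω ω′ → necklaces ω ≐ necklaces ω′ →
    ∀ A → dir (endDirection ω) A ≐ dir (endDirection ω′) A
  agree ω ω′ (ω⊆ω′ , _) A =
    let K-comp , K-tails = endDirection-IsK ω A
        K′-comp , K′-tails = endDirection-IsK ω′ A
    in tailContainer-unique K-comp K′-comp (K-tails (representative∈ ω))
         (K′-tails (ω⊆ω′ (representative∈ ω)))
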